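{- Let $n\ge 1$ and $\pi\in S_n$. Then $\pi\in\mathcal C_n(321)$ if and only if $\hat\pi_1=n$ and $\hat\pi$ avoids each of the five vincular patterns $\underline{32}\,\underline{41}$, $\underline{14}\,\underline{23}$, $\underline{41}\,\underline{32}$, $\underline{23}\,\underline{14}$, $\underline{23}\,\underline{1}$. Equivalently, $$\mathcal C_n(321)=\theta^{ -1}\big(S_{n,n}(\underline{32}\,\underline{41},\ \underline{14}\,\underline{23},\ \underline{41}\,\underline{32},\ \underline{23}\,\underline{14},\ \underline{23}\,\underline{1})\big),$$ where $S_{n,n}(\dots)$ is the set of permutations $w\in S_n$ with $w_1=n$ avoiding all listed patterns.
   Context: Permutations of $[n]=\{1,\dots,n\}$ are written in one-line notation $\pi=\pi_1\cdots\pi_n$ with $\pi_i=\pi(i)$. A permutation contains $321$ if there are $i<j<k$ with $\pi_i>\pi_j>\pi_k$, and avoids $321$ otherwise. $\mathcal C_n$ is the set of cyclic permutations of $[n]$ (cycle decomposition is a single $n$-cycle), and $\mathcal C_n(321)$ is the set of those avoiding $321$. The standard cycle notation of $\pi$ writes each cycle with its largest element first, as $(m,\pi(m),\pi^2(m),\dots)$, and lists the cycles in increasing order of their largest elements. The fundamental bijection $\theta:S_n\to S_n$ sends $\pi$ to the permutation whose one-line notation is obtained by erasing the parentheses from the standard cycle notation of $\pi$; write $\hat\pi=\theta(\pi)$. (Example: $\pi=964572813=(6,2)(9,3,4,5,7,8,1)$, so $\hat\pi=629345781$.) Vincular patterns: for a sequence $w=w_1\cdots w_N$ of distinct integers, -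 $w$ contains $\underline{32}\,\underline{41}$ if there are $i,j$ with $i+2\le j\le N-1$ and $w_{j+1}<w_{i+1}<w_i<w_j$; - $w$ contains $\underline{14}\,\underline{23}$ if there are such $i,j$ with $w_i<w_j<w_{j+1}<w_{i+1}$; - $w$ contains $\underline{41}\,\underline{32}$ if there are such $i,j$ with $w_{i+1}<w_{j+1}<w_j<w_i$; - $w$ contains $\underline{23}\,\underline{14}$ if there are such $i,j$ with $w_j<w_i<w_{i+1}<w_{j+1}$; - $w$ contains $\underline{23}\,\underline{1}$ if there is $i$ with $i+1\le N-1$ and $w_N<w_i<w_{i+1}$ (the "1" must be the last entry); - $w$ contains $\underline{1}\,\underline{32}$ if there is $j$ with $2\le j\le N-1$ and $w_1<w_{j+1}<w_j$ (the "1" must be the first entry). $w$ avoids a pattern if it does not contain it. -}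

module Defs where

open import Data.Fin.Base using (Fin; zero; suc; toℕ; fromℕ; inject₁; _≤_; _<_)
open import Data.Fin.Permutation using (Permutation′; _⟨$⟩ʳ_; _⟨$⟩ˡ_; inverseˡ; permutation; cast-id; ↔⇒≡; _∘ₚ_)
import Data.Fin.Permutation as Perm
open import Data.Fin.Properties using (_≟_; _≤?_; ≤-refl; ≤-trans; ≤-antisym; ≤-total; pigeonhole; toℕ≤pred[n])
open import Data.List.Base using (List; []; _∷_; [_]; length; map; concat; filter; takeWhile; iterate; applyUpTo; allFin; tabulate; lookup)
open import Data.List.Membership.Propositional using (_∈_)
open import Data.List.Membership.Propositional.Properties using (∈-applyUpTo⁺; ∈-applyUpTo⁻; ∈-concat⁺′; ∈-map⁺; ∈-filter⁺; ∈-allFin; ∈-lookup)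
open import Data.List.Properties using (tabulate-cong; tabulate-lookup)
open import Data.List.Relation.Unary.All as All using (All; []; _∷_; all?)
import Data.List.Relation.Unary.All.Properties as All
open import Data.List.Relation.Unary.AllPairs using (AllPairs; []; _∷_)
import Data.List.Relation.Unary.AllPairs.Properties as AllPairs
open import Data.List.Relation.Unary.Any using (here; there; index)
open import Data.List.Relation.Unary.Any.Properties using (lookup-index)
open import Data.List.Relation.Unary.Unique.Propositional using (Unique)
import Data.List.Relation.Unary.Unique.Propositional.Properties as Unique
open import Data.List.Relation.Binary.Disjoint.Propositional using (Disjoint)
open import Data.Nat.Base as ℕ using (ℕ; zero; suc; _+_; _∸_; s≤s; z≤n)
import Data.Nat.GeneralisedArithmetic as Iter
import Data.Nat.Properties as ℕ
open import Data.Product.Base using (∃; ∃₂; ∃-syntax; _×_; _,_; proj₁; proj₂)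
open import Data.Sum.Base using (inj₁; inj₂)
open import Data.Vec.Functional using (Vector)
open import Function.Base using (_∘_)
open import Relation.Binary.PropositionalEquality using (_≡_; _≢_; refl; sym; trans; cong; subst)
open import Relation.Nullary using (¬_; yes; no; ¬?; contradiction)
open import Relation.Unary using (Pred; Decidable)
open import Level using (0ℓ)

private
  variable
    n N : ℕ

-- The cycle (m , π m , π² m , …).  The first return to m happens after
-- at most n steps, so n iterates suffice.
cycleFrom : Permutation′ n → Fin n → List (Fin n)
cycleFrom {n} π m =
  m ∷ takeWhile (λ x → ¬? (x ≟ m)) (iterate (π ⟨$⟩ʳ_) (π ⟨$⟩ʳ m) n)

CycleMax : Permutation′ n → Pred (Fin n) 0ℓ
CycleMax π m = All (_≤ m) (cycleFrom π m)

cycleMax? : (π : Permutation′ n) → Decidable (CycleMax π)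
cycleMax? π m = all? (_≤? m) (cycleFrom π m)

-- allFin lists its elements in increasing order, so the cycles come in
-- increasing order of their largest elements.
standardCycles : Permutation′ n → List (List (Fin n))
standardCycles {n} π = map (cycleFrom π) (filter (cycleMax? π) (allFin n))

erased : Permutation′ n → List (Fin n)
erased π = concat (standardCycles π)

Cyclic : Pred (Permutation′ n) 0ℓ
Cyclic {n} π = ∃[ c ] standardCycles π ≡ [ c ] × length c ≡ n

-- `erased π` lists every element of Fin n exactly once, which makes it
-- the one-line notation of a permutation.
module _ {n : ℕ} (π : Permutation′ n) where

  private
    f : Fin n → Fin n
    f = π ⟨$⟩ʳ_

    infixr 8 f^_
    f^_ : ℕ → Fin n → Fin n
    (f^ k) x = Iter.iterate f x k

    f-injective : ∀ {x y} → f x ≡ f y → x ≡ y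
    f-injective {x} {y} eq =
      trans (sym (inverseˡ π)) (trans (cong (π ⟨$⟩ˡ_) eq) (inverseˡ π))

    f^-injective : ∀ k {x y} → (f^ k) x ≡ (f^ k) y → x ≡ y
    f^-injective zero    eq = eq
    f^-injective (suc k) eq = f-injective (f^-injective k eq)

    f^-+ : ∀ j k x → (f^ (j + k)) x ≡ (f^ k) ((f^ j) x)
    f^-+ zero    k x = refl
    f^-+ (suc j) k x = f^-+ j k (f x)

    f^-suc : ∀ k x → (f^ suc k) x ≡ f ((f^ k) x)
    f^-suc zero    x = refl
    f^-suc (suc k) x = f^-suc k (f x)

    cancel : ∀ {i j} x → i ℕ.≤ j → (f^ i) x ≡ (f^ j) x → x ≡ (f^ (j ∸ i)) x
    cancel {i} {j} x i≤j eq = f^-injective i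
      (trans eq (trans (cong (λ k → (f^ k) x) (sym (ℕ.m∸n+n≡m i≤j)))
                       (f^-+ (j ∸ i) i x)))

    returns : ∀ m → ∃[ k ] k ℕ.< n × (f^ k) (f m) ≡ m
    returns m with pigeonhole (ℕ.n<1+n n) (λ k → (f^ toℕ k) m)
    ... | i , j , i<j , eq with toℕ j ∸ toℕ i | ℕ.m<n⇒0<n∸m i<j | ℕ.m∸n≤m (toℕ j) (toℕ i) | cancel m (ℕ.<⇒≤ i<j) eq
    ...   | suc d | _ | d<j | eq′ = d , ℕ.≤-trans d<j (toℕ≤pred[n] j) , sym eq′

    takeWhile-orbit : ∀ m x N {k} → k ℕ.< N → (f^ k) x ≡ m →
      ∃[ p ] takeWhile (λ y → ¬? (y ≟ m)) (iterate f x N) ≡ applyUpTo (λ i → (f^ i) x) p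
           × (f^ p) x ≡ m × (∀ {i} → i ℕ.< p → (f^ i) x ≢ m)
    takeWhile-orbit m x (suc N) {k} k<N eq with x ≟ m
    ... | yes x≡m = 0 , refl , x≡m , λ ()
    takeWhile-orbit m x (suc N) {zero}  k<N       eq | no x≢m = contradiction eq x≢m
    takeWhile-orbit m x (suc N) {suc k} (s≤s k<N) eq | no x≢m
      with p , eqp , ret , min ← takeWhile-orbit m (f x) N k<N eq =
      suc p , cong (x ∷_) eqp , ret , λ { {zero} _ → x≢m ; {suc i} (s≤s i<p) → min i<p }

    cycleFrom-orbit : ∀ m →
      ∃[ p ] cycleFrom π m ≡ applyUpTo (λ i → (f^ i) m) (suc p)
           × (f^ suc p) m ≡ m × (∀ {i} → i ℕ.< p → (f^ suc i) m ≢ m)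
    cycleFrom-orbit m
      with k , k<n , eq ← returns m
      with p , eqp , ret , min ← takeWhile-orbit m (f m) n k<n eq =
      p , cong (m ∷_) eqp , ret , min

    cycleFrom-unique : ∀ m → Unique (cycleFrom π m)
    cycleFrom-unique m with p , eq , ret , min ← cycleFrom-orbit m =
      subst Unique (sym eq) (Unique.applyUpTo⁺₁ (λ i → (f^ i) m) (suc p) distinct)
      where
      distinct : ∀ {i j} → i ℕ.< j → j ℕ.< suc p → (f^ i) m ≢ (f^ j) m
      distinct {i} {j} i<j (s≤s j≤p) e
        with j ∸ i | ℕ.m<n⇒0<n∸m i<j | ℕ.m∸n≤m j i | cancel m (ℕ.<⇒≤ i<j) e
      ... | suc d | _ | d<j | e′ = min (ℕ.≤-trans d<j j≤p) (sym e′)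

  ∈-cycleFrom⁻ : ∀ {m x} → x ∈ cycleFrom π m → ∃[ k ] x ≡ Iter.iterate (π ⟨$⟩ʳ_) m k
  ∈-cycleFrom⁻ {m} {x} x∈ with p , eq , _ ← cycleFrom-orbit m
    with i , _ , e ← ∈-applyUpTo⁻ (λ i → (f^ i) m) (subst (x ∈_) eq x∈) = i , e

  ∈-cycleFrom⁺ : ∀ m k → Iter.iterate (π ⟨$⟩ʳ_) m k ∈ cycleFrom π m
  ∈-cycleFrom⁺ m k with p , eq , ret , _ ← cycleFrom-orbit m =
    subst ((f^ k) m ∈_) (sym eq) (go k)
    where
    go : ∀ k → (f^ k) m ∈ applyUpTo (λ i → (f^ i) m) (suc p)
    go zero = here refl
    go (suc k) with i , i≤p , e ← ∈-applyUpTo⁻ (λ i → (f^ i) m) (go k)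
      with ℕ.m≤n⇒m<n∨m≡n i≤p
    ... | inj₁ i<p  = subst (_∈ applyUpTo (λ i → (f^ i) m) (suc p))
                        (sym (trans (f^-suc k m) (trans (cong f e) (sym (f^-suc i m)))))
                        (∈-applyUpTo⁺ (λ i → (f^ i) m) i<p)
    ... | inj₂ refl = here (trans (f^-suc k m) (trans (cong f e) (trans (sym (f^-suc p m)) ret)))

  ∈-cycleFrom-trans : ∀ {x y z} → y ∈ cycleFrom π x → z ∈ cycleFrom π y → z ∈ cycleFrom π x
  ∈-cycleFrom-trans {x} y∈ z∈
    with j , refl ← ∈-cycleFrom⁻ y∈ | k , e ← ∈-cycleFrom⁻ z∈ =
    subst (_∈ cycleFrom π x) (trans (f^-+ j k x) (sym e)) (∈-cycleFrom⁺ x (j + k))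

  ∈-cycleFrom-sym : ∀ {x y} → y ∈ cycleFrom π x → x ∈ cycleFrom π y
  ∈-cycleFrom-sym {x} {y} y∈ with p , eq , ret , _ ← cycleFrom-orbit x
    with i , i≤p , refl ← ∈-applyUpTo⁻ (λ i → (f^ i) x) (subst (y ∈_) eq y∈) =
    subst (_∈ cycleFrom π y) back (∈-cycleFrom⁺ y (suc p ∸ i))
    where
    back : (f^ (suc p ∸ i)) ((f^ i) x) ≡ x
    back = trans (sym (f^-+ i (suc p ∸ i) x))
             (trans (cong (λ k → (f^ k) x) (ℕ.m+[n∸m]≡n (ℕ.<⇒≤ i≤p))) ret)

  private
    maximum : ∀ (x : Fin n) xs → ∃[ m ] m ∈ x ∷ xs × All (_≤ m) (x ∷ xs)
    maximum x [] = x , here refl , ≤-refl ∷ []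
    maximum x (y ∷ ys) with m , m∈ , ≤m ← maximum y ys with ≤-total x m
    ... | inj₁ x≤m = m , there m∈ , x≤m ∷ ≤m
    ... | inj₂ m≤x = x , here refl , ≤-refl ∷ All.map (λ z≤m → ≤-trans z≤m m≤x) ≤m

  ∈-erased : ∀ x → x ∈ erased π
  ∈-erased x with m , m∈ , ≤m ← maximum x _ =
    ∈-concat⁺′ (∈-cycleFrom-sym m∈)
      (∈-map⁺ (cycleFrom π) (∈-filter⁺ (cycleMax? π) (∈-allFin m)
        (All.tabulate λ z∈ → All.lookup ≤m (∈-cycleFrom-trans m∈ z∈))))

  private
    disjoint : ∀ {l m} → CycleMax π l → CycleMax π m → l ≢ m →
               Disjoint (cycleFrom π l) (cycleFrom π m)
    disjoint l-max m-max l≢m (x∈l , x∈m) = l≢m (≤-antisym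
      (All.lookup m-max (∈-cycleFrom-trans x∈m (∈-cycleFrom-sym x∈l)))
      (All.lookup l-max (∈-cycleFrom-trans x∈l (∈-cycleFrom-sym x∈m))))

    disjoints : ∀ {ms} → All (CycleMax π) ms → Unique ms →
                AllPairs (λ l m → Disjoint (cycleFrom π l) (cycleFrom π m)) ms
    disjoints []       []       = []
    disjoints (p ∷ ps) (q ∷ qs) =
      All.zipWith (λ (m-max , l≢m) {v} → disjoint p m-max l≢m {v}) (ps , q) ∷ disjoints ps qs

  erased-unique : Unique (erased π)
  erased-unique = Unique.concat⁺
    (All.map⁺ (All.universal cycleFrom-unique _))
    (AllPairs.map⁺ (disjoints (All.all-filter (cycleMax? π) (allFin n))
                              (Unique.filter⁺ (cycleMax? π) (Unique.allFin⁺ n))))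

  private
    lookup-injective : ∀ {xs : List (Fin n)} → Unique xs → ∀ {i j} → lookup xs i ≡ lookup xs j → i ≡ j
    lookup-injective (_  ∷ _)  {zero}  {zero}  _  = refl
    lookup-injective (x∉ ∷ _)  {zero}  {suc j} eq = contradiction eq (All.lookup x∉ (∈-lookup j))
    lookup-injective (x∉ ∷ _)  {suc i} {zero}  eq = contradiction (sym eq) (All.lookup x∉ (∈-lookup i))
    lookup-injective (_  ∷ xs) {suc i} {suc j} eq = cong suc (lookup-injective xs eq)

  lookupErased : Perm.Permutation (length (erased π)) n
  lookupErased = permutation (lookup (erased π)) (index ∘ ∈-erased)
    (λ x → sym (lookup-index (∈-erased x)))
    (λ i → lookup-injective erased-unique (sym (lookup-index (∈-erased _))))

  θ : Permutation′ n
  θ = cast-id (sym (↔⇒≡ lookupErased)) ∘ₚ lookupErased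

private
  tabulate-cast : ∀ {A : Set} {m n} (eq : m ≡ n) (g : Fin n → A) →
                  tabulate (g ∘ (cast-id eq ⟨$⟩ʳ_)) ≡ tabulate g
  tabulate-cast {m = zero}  refl g = refl
  tabulate-cast {m = suc m} refl g = cong (g zero ∷_) (tabulate-cast refl (g ∘ suc))

θ-oneLine : (π : Permutation′ n) → tabulate (θ π ⟨$⟩ʳ_) ≡ erased π
θ-oneLine π = trans
  (tabulate-cast (sym (↔⇒≡ (lookupErased π))) (lookup (erased π)))
  (tabulate-lookup (erased π))

Contains321 : Pred (Permutation′ n) 0ℓ
Contains321 π = ∃[ i ] ∃[ j ] ∃[ k ] i < j × j < k ×
  (π ⟨$⟩ʳ j) < (π ⟨$⟩ʳ i) × (π ⟨$⟩ʳ k) < (π ⟨$⟩ʳ j)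

-- 𝒞ₙ(321)
𝒞₃₂₁ : (n : ℕ) → Pred (Permutation′ n) 0ℓ
𝒞₃₂₁ n π = Cyclic π × ¬ Contains321 π

-- Entries of the one-line notation as elements of {1, …, n}.
oneLine : Permutation′ n → Vector ℕ n
oneLine σ i = suc (toℕ (σ ⟨$⟩ʳ i))

-- For a sequence w of length suc M, an index i : Fin M stands for the
-- adjacent pair of entries at the (0-based) positions i and i + 1, whose
-- values are w (inject₁ i) and w (suc i).
module _ {M : ℕ} (w : Vector ℕ (suc M)) where

  private
    fst snd : Fin M → ℕ
    fst i = w (inject₁ i)
    snd i = w (suc i)

  Contains-32-41 : Set
  Contains-32-41 = ∃₂ λ i j → 2 + toℕ i ℕ.≤ toℕ j ×
    snd j ℕ.< snd i × snd i ℕ.< fst i × fst i ℕ.< fst j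

  Contains-14-23 : Set
  Contains-14-23 = ∃₂ λ i j → 2 + toℕ i ℕ.≤ toℕ j ×
    fst i ℕ.< fst j × fst j ℕ.< snd j × snd j ℕ.< snd i

  Contains-41-32 : Set
  Contains-41-32 = ∃₂ λ i j → 2 + toℕ i ℕ.≤ toℕ j ×
    snd i ℕ.< snd j × snd j ℕ.< fst j × fst j ℕ.< fst i

  Contains-23-14 : Set
  Contains-23-14 = ∃₂ λ i j → 2 + toℕ i ℕ.≤ toℕ j ×
    fst j ℕ.< fst i × fst i ℕ.< snd i × snd i ℕ.< snd j

  -- The "1" is the last entry, and the pair "23" ends strictly before it.
  Contains-23-1 : Set
  Contains-23-1 = ∃ λ i → suc (toℕ i) ℕ.< M ×
    w (fromℕ M) ℕ.< fst i × fst i ℕ.< snd i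

  AvoidsFive : Set
  AvoidsFive = ¬ Contains-32-41 × ¬ Contains-14-23 × ¬ Contains-41-32
             × ¬ Contains-23-14 × ¬ Contains-23-1

-- S_{n,n}(32-41, 14-23, 41-32, 23-14, 23-1) for n = suc m
Sₙₙ : (m : ℕ) → Pred (Permutation′ (suc m)) 0ℓ
Sₙₙ m σ = oneLine σ zero ≡ suc m × AvoidsFive (oneLine σ)

{-# OPTIONS --safe #-}

-- A permutation π is cyclic exactly when π̂ starts with its largest entry n, and
-- then π sends every entry of π̂ to the next one, and the last entry to n.  So
-- 32-41 and 41-32 say that π(c) < π(b) < b < c for some b and c, and the other
-- three patterns say that a < b < π(b) < π(a) for some a and b (23-1 being the
-- case that a is the last entry).  Either configuration extends to an occurrence
-- of 321 by the pigeonhole principle; conversely, the middle entry of a 321 is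
-- not a fixed point of the cycle π, so it gives one of the two configurations.
module Submission where

open import Defs
open import Data.Nat.Base using (ℕ; suc)
open import Data.Fin.Base using (zero)
open import Data.Fin.Permutation using (Permutation′)
open import Data.Product.Base using (_×_)
open import Function.Bundles using (_⇔_)
open import Relation.Binary.PropositionalEquality using (_≡_)
open import Relation.Nullary using (¬_)
open import Relation.Unary using (_∈_; _≐_; _⊢_)

open import Data.Empty using (⊥)
open import Data.Fin.Base using (Fin; suc; toℕ; fromℕ; fromℕ<; inject; inject₁; _<_)
open import Data.Fin.Permutation using (_⟨$⟩ʳ_; _⟨$⟩ˡ_; inverseˡ; inverseʳ; flip)
open import Data.Fin.Properties using
  (_<?_; any?; pigeonhole; fromℕ<-injective; toℕ-injective; toℕ-inject;
   toℕ-inject₁; toℕ-fromℕ; toℕ<n; ≤fromℕ; ≤∧≢⇒<; <⇒≢; <-cmp; <-trans)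
open import Data.Fin.Relation.Unary.Top using (view; ‵fromℕ; ‵inject₁)
open import Data.List.Base using (List; []; _∷_; [_]; length; map; concat; filter; takeWhile; iterate; allFin; tabulate)
import Data.List.Membership.Propositional as List
open import Data.List.Membership.Propositional.Properties using (∈-map⁺; ∈-filter⁺; ∈-allFin)
open import Data.List.Properties using (∷-injectiveˡ; ∷-injectiveʳ; ++-identityʳ; length-tabulate)
import Data.List.Relation.Unary.All as All
open import Data.List.Relation.Unary.AllPairs using (AllPairs; _∷_)
import Data.List.Relation.Unary.AllPairs.Properties as AllPairs
open import Data.List.Relation.Unary.Any using (here)
import Data.Nat.Base as ℕ
import Data.Nat.Properties as ℕ
open import Data.Product.Base using (∃-syntax; _,_)
open import Data.Sum.Base using (_⊎_; inj₁; inj₂; [_,_]′)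
open import Function.Base using (_∘_)
open import Function.Bundles using (mk⇔; Equivalence; Injection)
open import Function.Properties.Inverse using (Inverse⇒Injection)
open import Relation.Binary.Definitions using (tri<; tri≈; tri>)
open import Relation.Binary.PropositionalEquality using (_≢_; refl; sym; trans; cong; subst)
open import Relation.Nullary using (yes; no; contradiction; _×-dec_)
open import Relation.Unary using (Pred; Decidable)
open import Level using (0ℓ)

private
  variable
    n : ℕ

-- Extending to a 321 by the pigeonhole principle.

⟨$⟩ʳ-injective : (π : Permutation′ n) → ∀ {x y} → π ⟨$⟩ʳ x ≡ π ⟨$⟩ʳ y → x ≡ y
⟨$⟩ʳ-injective π = Injection.injective (Inverse⇒Injection π)

inject-injective : ∀ {b : Fin n} {i j : Fin (toℕ b)} → inject i ≡ inject j → i ≡ j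
inject-injective {i = i} {j} eq =
  toℕ-injective (trans (sym (toℕ-inject i)) (trans (cong toℕ eq) (toℕ-inject j)))

inject-< : ∀ {b : Fin n} (i : Fin (toℕ b)) → inject i < b
inject-< {b = b} i = subst (ℕ._< toℕ b) (sym (toℕ-inject i)) (toℕ<n i)

-- Otherwise `π` would inject the `b` positions below `b` into the fewer values below `c`.
maps-below⇒≮ : (π : Permutation′ n) → ∀ {b c : Fin n} →
                (∀ {a : Fin n} → a < b → π ⟨$⟩ʳ a < c) → ¬ (c < b)
maps-below⇒≮ π below c<b
  with i , j , i<j , eq ← pigeonhole c<b (λ k → fromℕ< (below (inject-< k))) =
  contradiction
    (inject-injective (⟨$⟩ʳ-injective π (toℕ-injective (fromℕ<-injective _ _ _ _ eq))))
    (<⇒≢ i<j)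

-- Supplies the "3" of a 321 with middle position `b`. Without it, every position below `b` would be
-- sent below `π b`, although `π b < b`.
<⇒larger-before : (π : Permutation′ n) → ∀ {b} → π ⟨$⟩ʳ b < b →
                  ∃[ a ] a < b × π ⟨$⟩ʳ b < π ⟨$⟩ʳ a
<⇒larger-before π {b} πb<b with any? (λ a → (a <? b) ×-dec (π ⟨$⟩ʳ b <? π ⟨$⟩ʳ a))
... | yes found = found
... | no none = contradiction πb<b (maps-below⇒≮ π λ a<b →
  ≤∧≢⇒< (ℕ.≮⇒≥ (λ πb<πa → none (_ , a<b , πb<πa))) (<⇒≢ a<b ∘ ⟨$⟩ʳ-injective π))

>⇒smaller-after : (π : Permutation′ n) → ∀ {b} → b < π ⟨$⟩ʳ b →
                  ∃[ c ] b < c × π ⟨$⟩ʳ c < π ⟨$⟩ʳ b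
>⇒smaller-after π {b} b<πb
  -- The inverse of `π` sends `π b` to the smaller `b`, so the previous lemma applies to it;
  -- positions and values trade roles.
  with x , x<πb , lt ← <⇒larger-before (flip π) (subst (_< π ⟨$⟩ʳ b) (sym (inverseˡ π)) b<πb) =
  π ⟨$⟩ˡ x , subst (_< π ⟨$⟩ˡ x) (inverseˡ π) lt
           , subst (_< π ⟨$⟩ʳ b) (sym (inverseʳ π)) x<πb

-- Pattern occurrences in a word that follows the cycle.

apart : ∀ {i j} → i ≢ j → suc i ≢ j → suc j ≢ i → 2 ℕ.+ i ℕ.≤ j ⊎ 2 ℕ.+ j ℕ.≤ i
apart i≢j 1+i≢j 1+j≢i with ℕ.<-cmp _ _
... | tri< i<j _ _ = inj₁ (ℕ.≤∧≢⇒< i<j 1+i≢j)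
... | tri≈ _ i≡j _ = contradiction i≡j i≢j
... | tri> _ _ j<i = inj₂ (ℕ.≤∧≢⇒< j<i 1+j≢i)

-- All that the pattern argument uses about `θ π`, free of lists. The closing of the cycle is not a
-- field: `wrap` derives it.
record IsCycleWord {m} (π σ : Permutation′ (suc m)) : Set where
  field
    head : σ ⟨$⟩ʳ zero ≡ fromℕ m
    step : ∀ i → σ ⟨$⟩ʳ suc i ≡ π ⟨$⟩ʳ (σ ⟨$⟩ʳ inject₁ i)

module _ {m} {π σ : Permutation′ (suc m)} (isCycleWord : IsCycleWord π σ) where
  open IsCycleWord isCycleWord

  private
    w : Fin (suc m) → ℕ
    w = oneLine σ

    data Position : Fin (suc m) → Set where
      inner : ∀ i → Position (σ ⟨$⟩ʳ inject₁ i)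
      last  : Position (σ ⟨$⟩ʳ fromℕ m)

    position : ∀ x → Position x
    position x = subst Position (inverseʳ σ) (at (σ ⟨$⟩ˡ x))
      where
      at : ∀ k → Position (σ ⟨$⟩ʳ k)
      at k with view k
      ... | ‵fromℕ     = last
      ... | ‵inject₁ i = inner i

  -- If `π` sent an inner entry to n, `step` would put n at a successor position, but `head` has it
  -- at `zero`.
  wrap : π ⟨$⟩ʳ (σ ⟨$⟩ʳ fromℕ m) ≡ fromℕ m
  wrap = trans (cong (π ⟨$⟩ʳ_) (sym (preimage (position (π ⟨$⟩ˡ fromℕ m)) (inverseʳ π)))) (inverseʳ π)
    where
    preimage : ∀ {x} → Position x → π ⟨$⟩ʳ x ≡ fromℕ m → x ≡ σ ⟨$⟩ʳ fromℕ m
    preimage last      _  = refl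
    preimage (inner i) eq =
      contradiction (⟨$⟩ʳ-injective σ (trans (step i) (trans eq (sym head)))) λ ()

  -- A fixed inner entry would equal its successor in the word; a fixed last entry would be n, hence
  -- also the first entry. Then the word has length 1, which `a < b` excludes.
  fixedPoint-free : ∀ {a b : Fin (suc m)} → a < b → π ⟨$⟩ʳ b ≢ b
  fixedPoint-free {a} {b} a<b with position b
  ... | inner i = λ eq →
    ℕ.1+n≢n (trans (cong toℕ (⟨$⟩ʳ-injective σ (trans (step i) eq))) (toℕ-inject₁ i))
  ... | last = λ eq → m≢0 (trans (sym (toℕ-fromℕ m)) (sym (cong toℕ
    (⟨$⟩ʳ-injective σ (trans head (trans (sym wrap) eq))))))
    where
    m≢0 : m ≢ 0
    m≢0 refl with σ ⟨$⟩ʳ fromℕ 0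
    m≢0 refl | zero = contradiction a<b λ ()

  private
    -- The patterns want two adjacent pairs without a common position. Inequalities between entries
    -- ensure this, and the order of the pairs then decides which of two mirrored patterns occurs.
    disjointPairs : ∀ i j → σ ⟨$⟩ʳ inject₁ i ≢ σ ⟨$⟩ʳ inject₁ j →
      σ ⟨$⟩ʳ suc i ≢ σ ⟨$⟩ʳ inject₁ j → σ ⟨$⟩ʳ suc j ≢ σ ⟨$⟩ʳ inject₁ i →
      2 ℕ.+ toℕ i ℕ.≤ toℕ j ⊎ 2 ℕ.+ toℕ j ℕ.≤ toℕ i
    disjointPairs i j p q r = apart
      (p ∘ cong (λ k → σ ⟨$⟩ʳ inject₁ k) ∘ toℕ-injective) (q ∘ next) (r ∘ next)
      where
      next : ∀ {i j : Fin m} → suc (toℕ i) ≡ toℕ j → σ ⟨$⟩ʳ suc i ≡ σ ⟨$⟩ʳ inject₁ j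
      next {j = j} eq = cong (σ ⟨$⟩ʳ_) (toℕ-injective (trans eq (sym (toℕ-inject₁ j))))

    -- Covers both 32-41 and 41-32, which differ only in which pair comes first: `b` starts the pair
    -- 32 and `c` the pair 41.
    falling : ∀ {i j} → w (suc j) ℕ.< w (suc i) → w (suc i) ℕ.< w (inject₁ i) →
              w (inject₁ i) ℕ.< w (inject₁ j) → Contains321 π
    falling {i} {j} πc<πb πb<b b<c rewrite step i | step j
      with a , a<b , πb<πa ← <⇒larger-before π (ℕ.s<s⁻¹ πb<b) =
      a , _ , _ , a<b , ℕ.s<s⁻¹ b<c , πb<πa , ℕ.s<s⁻¹ πc<πb

    rising : ∀ {a b} → a < b → b < π ⟨$⟩ʳ b → π ⟨$⟩ʳ b < π ⟨$⟩ʳ a → Contains321 π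
    rising a<b b<πb πb<πa with c , b<c , πc<πb ← >⇒smaller-after π b<πb =
      _ , _ , c , a<b , b<c , πb<πa , πc<πb

    rising-inner : ∀ {i j} → w (inject₁ i) ℕ.< w (inject₁ j) → w (inject₁ j) ℕ.< w (suc j) →
                   w (suc j) ℕ.< w (suc i) → Contains321 π
    rising-inner {i} {j} a<b b<πb πb<πa rewrite step i | step j =
      rising (ℕ.s<s⁻¹ a<b) (ℕ.s<s⁻¹ b<πb) (ℕ.s<s⁻¹ πb<πa)

    rising-last : ∀ {i} → w (fromℕ m) ℕ.< w (inject₁ i) → w (inject₁ i) ℕ.< w (suc i) →
                  Contains321 π
    rising-last {i} a<b b<πb rewrite step i = rising (ℕ.s<s⁻¹ a<b) (ℕ.s<s⁻¹ b<πb)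
      -- Here `a` is the last entry, so `π a` is n by `wrap`; and `π b` is not n, since `a` and `b`
      -- differ.
      (subst (π ⟨$⟩ʳ (σ ⟨$⟩ʳ inject₁ i) <_) (sym wrap) (≤∧≢⇒< (≤fromℕ _) λ eq →
        <⇒≢ (ℕ.s<s⁻¹ a<b) (sym (⟨$⟩ʳ-injective π (trans eq (sym wrap))))))

    ≮fromℕ : ∀ {x : Fin (suc m)} → ¬ (fromℕ m < x)
    ≮fromℕ {x} lt = ℕ.<⇒≱ lt (≤fromℕ x)

  avoids321⇒avoidsFive : ¬ Contains321 π → AvoidsFive w
  avoids321⇒avoidsFive no321 =
      (λ (i , j , _ , p , q , r) → no321 (falling p q r))
    , (λ (i , j , _ , p , q , r) → no321 (rising-inner p q r))
    , (λ (i , j , _ , p , q , r) → no321 (falling p q r))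
    , (λ (i , j , _ , p , q , r) → no321 (rising-inner p q r))
    , (λ (i , _ , p , q) → no321 (rising-last p q))

  avoidsFive⇒avoids321 : AvoidsFive w → ¬ Contains321 π
  avoidsFive⇒avoids321 (no3241 , no1423 , no4132 , no2314 , no231)
                       (a , b , c , a<b , b<c , πb<πa , πc<πb) with <-cmp (π ⟨$⟩ʳ b) b
  ... | tri≈ _ πb≡b _ = fixedPoint-free a<b πb≡b
  ... | tri< πb<b _ _ = fall (position b) (position c) πb<πa b<c πb<b πc<πb
    where
    fall : ∀ {b c x} → Position b → Position c → π ⟨$⟩ʳ b < x →
           b < c → π ⟨$⟩ʳ b < b → π ⟨$⟩ʳ c < π ⟨$⟩ʳ b → ⊥
    -- The last entry is sent to n, but `π b` and `π c` both lie below another value, so `b` and `c`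
    -- are inner.
    fall last _ πb<x _ _ _ rewrite wrap = ≮fromℕ πb<x
    fall (inner i) last _ _ _ πc<πb rewrite wrap = ≮fromℕ πc<πb
    fall (inner i) (inner j) _ b<c πb<b πc<πb rewrite sym (step i) | sym (step j) =
      [ (λ far → no3241 (i , j , far , ℕ.s<s πc<πb , ℕ.s<s πb<b , ℕ.s<s b<c))
      , (λ far → no4132 (j , i , far , ℕ.s<s πc<πb , ℕ.s<s πb<b , ℕ.s<s b<c))
      ]′ (disjointPairs i j (<⇒≢ b<c) (<⇒≢ (<-trans πb<b b<c)) (<⇒≢ (<-trans πc<πb πb<b)))
  ... | tri> _ _ b<πb = rise (position b) (position a) a<b b<πb πb<πa
    where
    rise : ∀ {b a} → Position b → Position a →
           a < b → b < π ⟨$⟩ʳ b → π ⟨$⟩ʳ b < π ⟨$⟩ʳ a → ⊥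
    rise last _ _ _ πb<πa rewrite wrap = ≮fromℕ πb<πa
    rise (inner j) last a<b b<πb _ rewrite sym (step j) =
      no231 (j , ℕ.≤∧≢⇒< (toℕ<n j) 1+j≢m , ℕ.s<s a<b , ℕ.s<s b<πb)
      where
      -- The pair must end before the last position: its second entry `π b` exceeds the last entry
      -- `a`.
      1+j≢m : suc (toℕ j) ≢ m
      1+j≢m eq = <⇒≢ (<-trans a<b b<πb)
        (cong (σ ⟨$⟩ʳ_) (toℕ-injective (trans (toℕ-fromℕ m) (sym eq))))
    rise (inner j) (inner i) a<b b<πb πb<πa rewrite sym (step i) | sym (step j) =
      [ (λ far → no1423 (i , j , far , ℕ.s<s a<b , ℕ.s<s b<πb , ℕ.s<s πb<πa))
      , (λ far → no2314 (j , i , far , ℕ.s<s a<b , ℕ.s<s b<πb , ℕ.s<s πb<πa))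
      ]′ (disjointPairs i j (<⇒≢ a<b) (<⇒≢ (<-trans b<πb πb<πa) ∘ sym)
                            (<⇒≢ (<-trans a<b b<πb) ∘ sym))

-- From the list of cycles to the word of `θ π`.

-- Wherever `takeWhile` cuts the orbit, the entries kept are consecutive iterates. A cut right after
-- `x` would leave one entry, while `g` has at least two as soon as an `i` exists.
tabulate-takeWhile-iterate :
  ∀ {A : Set} {P : Pred A 0ℓ} (P? : Decidable P) (f : A → A) {m} (g : Fin (suc m) → A) {x} N →
  tabulate g ≡ x ∷ takeWhile P? (iterate f (f x) N) → ∀ i → g (suc i) ≡ f (g (inject₁ i))
tabulate-takeWhile-iterate P? f {suc m} g ℕ.zero eq i = contradiction (∷-injectiveʳ eq) λ ()
tabulate-takeWhile-iterate P? f {suc m} g {x} (suc N) eq i with P? (f x)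
... | no  _ = contradiction (∷-injectiveʳ eq) λ ()
... | yes _ with i
...   | zero  = trans (∷-injectiveˡ (∷-injectiveʳ eq)) (cong f (sym (∷-injectiveˡ eq)))
...   | suc i = tabulate-takeWhile-iterate P? f (g ∘ suc) N (∷-injectiveʳ eq) i

module _ {m} (π : Permutation′ (suc m)) where

  private
    maxima : List (Fin (suc m))
    maxima = filter (cycleMax? π) (allFin (suc m))

    topCycle : List (Fin (suc m))
    topCycle = cycleFrom π (fromℕ m)

  singleCycle⇒erased : standardCycles π ≡ [ topCycle ] → erased π ≡ topCycle
  singleCycle⇒erased eq = trans (cong concat eq) (++-identityʳ _)

  singleCycle⇒isCycleWord : standardCycles π ≡ [ topCycle ] → IsCycleWord π (θ π)
  singleCycle⇒isCycleWord eq = record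
    { head = ∷-injectiveˡ oneLine≡
    ; step = tabulate-takeWhile-iterate _ (π ⟨$⟩ʳ_) (θ π ⟨$⟩ʳ_) _ oneLine≡
    }
    where
    oneLine≡ : tabulate (θ π ⟨$⟩ʳ_) ≡ topCycle
    oneLine≡ = trans (θ-oneLine π) (singleCycle⇒erased eq)

  -- n is the maximum of its own cycle, so `topCycle` is always listed; a one-element list must
  -- consist of it.
  cyclic⇒singleCycle : Cyclic π → standardCycles π ≡ [ topCycle ]
  cyclic⇒singleCycle (c , eq , _) with here refl ← subst (topCycle List.∈_) eq
    (∈-map⁺ (cycleFrom π) (∈-filter⁺ (cycleMax? π) (∈-allFin _) (All.universal ≤fromℕ _))) = eq

  singleCycle⇒cyclic : standardCycles π ≡ [ topCycle ] → Cyclic π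
  singleCycle⇒cyclic eq = _ , eq , trans
    (cong length (sym (trans (θ-oneLine π) (singleCycle⇒erased eq)))) (length-tabulate (θ π ⟨$⟩ʳ_))

  -- The word starts with the smallest cycle maximum, because the maxima are listed in increasing
  -- order. If that is n, no second cycle can follow.
  headTop⇒singleCycle : θ π ⟨$⟩ʳ zero ≡ fromℕ m → standardCycles π ≡ [ topCycle ]
  headTop⇒singleCycle eq = cong (map (cycleFrom π))
    (firstTop maxima (AllPairs.filter⁺ (cycleMax? π) (AllPairs.tabulate⁺-< λ i<j → i<j))
              (θ-oneLine π))
    where
    firstTop : ∀ ms → AllPairs _<_ ms →
               tabulate (θ π ⟨$⟩ʳ_) ≡ concat (map (cycleFrom π) ms) → ms ≡ [ fromℕ m ]
    firstTop [] _ ()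
    firstTop (x ∷ []) _ eq′ = cong [_] (trans (sym (∷-injectiveˡ eq′)) eq)
    firstTop (x ∷ y ∷ _) ((x<y All.∷ _) ∷ _) eq′ = contradiction
      (subst (_< y) (trans (sym (∷-injectiveˡ eq′)) eq) x<y) (ℕ.≤⇒≯ (≤fromℕ y))

  cyclic321⇔ : π ∈ 𝒞₃₂₁ (suc m) ⇔ θ π ∈ Sₙₙ m
  cyclic321⇔ = mk⇔
    (λ (cyc , no321) → let isCW = singleCycle⇒isCycleWord (cyclic⇒singleCycle cyc) in
      cong suc (trans (cong toℕ (IsCycleWord.head isCW)) (toℕ-fromℕ m))
      , avoids321⇒avoidsFive isCW no321)
    (λ (top , avoids) →
      let single = headTop⇒singleCycle
                     (toℕ-injective (trans (ℕ.suc-injective top) (sym (toℕ-fromℕ m))))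
      in singleCycle⇒cyclic single
       , avoidsFive⇒avoids321 (singleCycle⇒isCycleWord single) avoids)

mainTheorem1 : (m : ℕ) →
    ((π : Permutation′ (suc m)) →
    π ∈ 𝒞₃₂₁ (suc m) ⇔
    (oneLine (θ π) zero ≡ suc m
    × ¬ Contains-32-41 (oneLine (θ π))
    × ¬ Contains-14-23 (oneLine (θ π))
    × ¬ Contains-41-32 (oneLine (θ π))
    × ¬ Contains-23-14 (oneLine (θ π))
    × ¬ Contains-23-1 (oneLine (θ π))))
    × (𝒞₃₂₁ (suc m) ≐ (θ ⊢ Sₙₙ m))
mainTheorem1 m = cyclic321⇔
  , (λ {π} → Equivalence.to (cyclic321⇔ π))
  , (λ {π} → Equivalence.from (cyclic321⇔ π))
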